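{- Let $k\ge1$ and let $(A,t)$ be a nontrivial $\mathcal{C}_k$-algebra. The following are equivalent: (i) $(A,t)$ is a simple algebra; (ii) for every $a\in A$ with $a\neq1$, $\bigwedge_{j=1}^{k}t^j(\triangle a)=0$; (iii) $K(A)=\{0,1\}$, where $K(A)=\{x\in A: t(x)=x=\nabla x\}$.
   Context: A modal pseudocomplemented De Morgan algebra ($mpM$-algebra) is an algebra $\langle A,\wedge,\vee,\sim,{}^\ast,0,1\rangle$ such that $\langle A,\wedge,\vee,\sim,0,1\rangle$ is a De Morgan algebra (bounded distributive lattice with $\sim\sim x=x$, $\sim(x\vee y)=\sim x\wedge\sim y$), $x^\ast$ is the pseudocomplement of $x$, and $x\vee\sim x\le x\vee x^\ast$. Put $\nabla x=\sim(\sim x\wedge x^\ast)$, $\triangle x=\sim\nabla\sim x$. A $\mathcal{C}_k$-algebra ($k\ge1$) is a pair $(A,t)$ with $A$ an $mpM$-algebra and $t$ an $mpM$-automorphism of $A$ with $t^k=\mathrm{id}$; simplicity refers to the signature $(\wedge,\vee,\sim,{}^\ast,t,0,1)$. -}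

module Defs where

open import Algebra.Core using (Op₁; Op₂)
open import Algebra.Definitions using (Identity; Involutive; Congruent₁)
open import Algebra.Lattice.Bundles using (RawLattice)
open import Algebra.Lattice.Morphism.Structures using (IsLatticeIsomorphism)
open import Algebra.Lattice.Structures using (IsDistributiveLattice)
open import Data.Nat.Base using (ℕ; zero; suc)
open import Data.Nat.GeneralisedArithmetic using (fold)
open import Data.Product.Base using (_×_; ∃₂)
open import Data.Sum.Base using (_⊎_)
open import Level using (Level; _⊔_) renaming (suc to lsuc)
open import Relation.Binary.Core using (Rel; _⇒_; _Preserves_⟶_; _Preserves₂_⟶_⟶_)
open import Relation.Binary.Definitions using (Universal)
open import Relation.Binary.Structures using (IsEquivalence)
open import Relation.Nullary.Negation.Core using (¬_)
open import Relation.Unary using (Pred; _≐_)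

record IsDeMorganAlgebra {c ℓ} {A : Set c} (_≈_ : Rel A ℓ)
         (_∧_ _∨_ : Op₂ A) (∼_ : Op₁ A) (0# 1# : A) : Set (c ⊔ ℓ) where
  field
    isDistributiveLattice : IsDistributiveLattice _≈_ _∨_ _∧_
    ∨-identity            : Identity _≈_ 0# _∨_
    ∧-identity            : Identity _≈_ 1# _∧_
    ∼-cong                : Congruent₁ _≈_ ∼_
    ∼-involutive          : Involutive _≈_ ∼_
    ∼-∨                   : ∀ x y → (∼ (x ∨ y)) ≈ ((∼ x) ∧ (∼ y))

  open IsDistributiveLattice isDistributiveLattice public

record MpMAlgebra c ℓ : Set (lsuc (c ⊔ ℓ)) where
  infix  9 _*
  infix  8 ∼_
  infixr 7 _∧_
  infixr 6 _∨_
  infix  4 _≈_ _≤_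
  field
    Carrier : Set c
    _≈_     : Rel Carrier ℓ
    _∧_     : Op₂ Carrier
    _∨_     : Op₂ Carrier
    ∼_      : Op₁ Carrier
    _*      : Op₁ Carrier
    0#      : Carrier
    1#      : Carrier

  _≤_ : Rel Carrier ℓ
  x ≤ y = (x ∧ y) ≈ x

  IsPseudocomplement : Carrier → Carrier → Set (c ⊔ ℓ)
  IsPseudocomplement x p = (x ∧ p) ≈ 0# × (∀ y → (x ∧ y) ≈ 0# → y ≤ p)

  field
    isDeMorganAlgebra  : IsDeMorganAlgebra _≈_ _∧_ _∨_ ∼_ 0# 1#
    *-pseudocomplement : ∀ x → IsPseudocomplement x (x *)
    modal              : ∀ x → (x ∨ ∼ x) ≤ (x ∨ x *)

  open IsDeMorganAlgebra isDeMorganAlgebra public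

  rawLattice : RawLattice c ℓ
  rawLattice = record { Carrier = Carrier ; _≈_ = _≈_ ; _∧_ = _∧_ ; _∨_ = _∨_ }

  ∇ : Op₁ Carrier
  ∇ x = ∼ (∼ x ∧ x *)

  △ : Op₁ Carrier
  △ x = ∼ ∇ (∼ x)

record IsMpMAutomorphism {c ℓ} (A : MpMAlgebra c ℓ)
         (t : Op₁ (MpMAlgebra.Carrier A)) : Set (c ⊔ ℓ) where
  open MpMAlgebra A
  field
    isLatticeIsomorphism : IsLatticeIsomorphism rawLattice rawLattice t
    ∼-homo               : ∀ x → t (∼ x) ≈ ∼ t x
    *-homo               : ∀ x → t (x *) ≈ (t x) *
    0#-homo              : t 0# ≈ 0#
    1#-homo              : t 1# ≈ 1#

  open IsLatticeIsomorphism isLatticeIsomorphism public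

record CAlgebra (k : ℕ) c ℓ : Set (lsuc (c ⊔ ℓ)) where
  field
    mpMAlgebra : MpMAlgebra c ℓ

  open MpMAlgebra mpMAlgebra public

  field
    t                 : Op₁ Carrier
    isMpMAutomorphism : IsMpMAutomorphism mpMAlgebra t

  infix 10 t^_
  t^_ : ℕ → Op₁ Carrier
  (t^ j) x = fold x t j

  field
    t^k≈id : ∀ x → (t^ k) x ≈ x

  Nontrivial : Set (c ⊔ ℓ)
  Nontrivial = ∃₂ λ x y → ¬ (x ≈ y)

  -- Equality of elements is _≈_, so reflexivity of a congruence means
  -- that it contains _≈_.
  record IsCongruence {p} (θ : Rel Carrier p) : Set (c ⊔ ℓ ⊔ p) where
    field
      isEquivalence : IsEquivalence θ
      ≈⇒θ           : _≈_ ⇒ θ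
      ∧-compatible  : _∧_ Preserves₂ θ ⟶ θ ⟶ θ
      ∨-compatible  : _∨_ Preserves₂ θ ⟶ θ ⟶ θ
      ∼-compatible  : ∼_ Preserves θ ⟶ θ
      *-compatible  : _* Preserves θ ⟶ θ
      t-compatible  : t Preserves θ ⟶ θ

  -- The only congruences are the identity and the total relation;
  -- nontriviality is kept separate.  The level c ⊔ ℓ accommodates generated
  -- congruences; under excluded middle the choice of level is immaterial.
  Simple : Set (lsuc (c ⊔ ℓ))
  Simple = ∀ (θ : Rel Carrier (c ⊔ ℓ)) → IsCongruence θ → (θ ⇒ _≈_) ⊎ Universal θ

  -- ⋀[1⋯ n ] f = f 1 ∧ ⋯ ∧ f n
  ⋀[1⋯_] : ℕ → (ℕ → Carrier) → Carrier
  ⋀[1⋯ zero  ] f = 1#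
  ⋀[1⋯ suc n ] f = ⋀[1⋯ n ] f ∧ f (suc n)

  K : Pred Carrier ℓ
  K x = t x ≈ x × x ≈ ∇ x

  ｛0,1｝ : Pred Carrier ℓ
  ｛0,1｝ x = x ≈ 0# ⊎ x ≈ 1#

  OrbitMeetsVanish : Set (c ⊔ ℓ)
  OrbitMeetsVanish = ∀ a → ¬ (a ≈ 1#) → ⋀[1⋯ k ] (λ j → (t^ j) (△ a)) ≈ 0#

  KTrivial : Set (c ⊔ ℓ)
  KTrivial = K ≐ ｛0,1｝

{-# OPTIONS --safe #-}

-- Call x complemented if x ∧ ∼x = 0.  All values of ∇ and △ are complemented, and
-- K(A) consists of the complemented fixed points of t.
-- (i) ⇒ (iii): for x ∈ K(A), the relation a ∧ x = b ∧ x is a congruence; it identifies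
-- x with 1, and it identifies 0 with 1 only if x = 0.
-- (iii) ⇒ (ii): the orbit meet of △a is a t-fixed complemented element below a.
-- (ii) ⇒ (iii): an element of K(A) is its own orbit meet.
-- (ii) ⇒ (i): comparable elements are determined by their values under ∇ and △, so a
-- congruence under which only 1 is congruent to 1 is the identity; and if e ≠ 1 is
-- congruent to 1, then so is the orbit meet of △e, which is 0.
module Submission where

open import Defs
open import Algebra.Lattice.Bundles using (DistributiveLattice)
import Algebra.Lattice.Properties.DistributiveLattice as DistributiveLatticeProperties
open import Axiom.ExcludedMiddle using (ExcludedMiddle)
open import Data.Nat.Base using (ℕ; zero; suc; _≤_; s≤s)
open import Data.Product.Base using (_×_; _,_; proj₁; proj₂; ∃)
open import Data.Sum.Base using (_⊎_; inj₁; inj₂)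
open import Function.Base using (_∘_)
open import Function.Bundles using (_⇔_; mk⇔)
open import Level using (Level; _⊔_; Lift; lift; lower)
open import Relation.Binary.Core using (Rel; _⇒_)
open import Relation.Binary.Definitions using (Universal)
import Relation.Binary.Lattice.Bundles as OrderTheoretic
import Relation.Binary.Lattice.Properties.JoinSemilattice as JoinSemilatticeProperties
import Relation.Binary.Lattice.Properties.MeetSemilattice as MeetSemilatticeProperties
import Relation.Binary.Reasoning.PartialOrder as PartialOrderReasoning
open import Relation.Binary.Structures using (IsEquivalence)
open import Relation.Nullary.Decidable.Core using (Dec; yes; no; decidable-stable; map′)
open import Relation.Nullary.Negation.Core using (¬_; contradiction)

module MpMAlgebraProperties {c ℓ} (A : MpMAlgebra c ℓ) where
  open MpMAlgebra A hiding (_≤_)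

  distributiveLattice : DistributiveLattice c ℓ
  distributiveLattice = record { isDistributiveLattice = isDistributiveLattice }

  open DistributiveLatticeProperties distributiveLattice public
    using (∧-idem; ∨-∧-orderTheoreticLattice)
  open OrderTheoretic.Lattice ∨-∧-orderTheoreticLattice public
    using (poset; antisym; x≤x∨y; y≤x∨y; ∨-least; x∧y≤x; x∧y≤y; ∧-greatest)
    renaming (_≤_ to _⊑_; refl to ⊑-refl; reflexive to ⊑-reflexive; trans to ⊑-trans)
  open OrderTheoretic.Lattice ∨-∧-orderTheoreticLattice
    using (joinSemilattice; meetSemilattice)
  open JoinSemilatticeProperties joinSemilattice public using (∨-monotonic; x≤y⇒x∨y≈y)
  open MeetSemilatticeProperties meetSemilattice public using (∧-monotonic)
  open PartialOrderReasoning poset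

  -- Bounds, De Morgan laws and the pseudocomplement.

  x⊑1 : ∀ x → x ⊑ 1#
  x⊑1 x = sym (proj₂ ∧-identity x)

  0⊑x : ∀ x → 0# ⊑ x
  0⊑x x = ⊑-trans (x≤x∨y 0# x) (⊑-reflexive (proj₁ ∨-identity x))

  ∼-antitone : ∀ {x y} → x ⊑ y → ∼ y ⊑ ∼ x
  ∼-antitone {x} {y} x⊑y = begin
    ∼ y          ≈⟨ ∼-cong (x≤y⇒x∨y≈y x⊑y) ⟨
    ∼ (x ∨ y)    ≈⟨ ∼-∨ x y ⟩
    ∼ x ∧ ∼ y    ≤⟨ x∧y≤x (∼ x) (∼ y) ⟩
    ∼ x          ∎

  ∼-∧ : ∀ x y → ∼ (x ∧ y) ≈ ∼ x ∨ ∼ y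
  ∼-∧ x y = begin-equality
    ∼ (x ∧ y)            ≈⟨ ∼-cong (∧-cong (∼-involutive x) (∼-involutive y)) ⟨
    ∼ (∼ ∼ x ∧ ∼ ∼ y)    ≈⟨ ∼-cong (∼-∨ (∼ x) (∼ y)) ⟨
    ∼ ∼ (∼ x ∨ ∼ y)      ≈⟨ ∼-involutive (∼ x ∨ ∼ y) ⟩
    ∼ x ∨ ∼ y            ∎

  ∼1≈0 : ∼ 1# ≈ 0#
  ∼1≈0 = antisym
    (⊑-trans (∼-antitone (x⊑1 (∼ 0#))) (⊑-reflexive (∼-involutive 0#)))
    (0⊑x (∼ 1#))

  ∼0≈1 : ∼ 0# ≈ 1#
  ∼0≈1 = trans (∼-cong (sym ∼1≈0)) (∼-involutive 1#)

  *-greatest : ∀ {x y} → x ∧ y ⊑ 0# → y ⊑ x *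
  *-greatest {x} {y} xy⊑0 =
    sym (proj₂ (*-pseudocomplement x) y (antisym xy⊑0 (0⊑x (x ∧ y))))

  x∧x*≈0 : ∀ x → x ∧ x * ≈ 0#
  x∧x*≈0 x = proj₁ (*-pseudocomplement x)

  *-antitone : ∀ {x y} → x ⊑ y → y * ⊑ x *
  *-antitone {x} {y} x⊑y = *-greatest (begin
    x ∧ y *    ≤⟨ ∧-monotonic x⊑y ⊑-refl ⟩
    y ∧ y *    ≈⟨ x∧x*≈0 y ⟩
    0#         ∎)

  *-cong : ∀ {x y} → x ≈ y → x * ≈ y *
  *-cong x≈y = antisym (*-antitone (⊑-reflexive (sym x≈y))) (*-antitone (⊑-reflexive x≈y))

  -- The operators `∇` and `△`.

  ∇-cong : ∀ {x y} → x ≈ y → ∇ x ≈ ∇ y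
  ∇-cong x≈y = ∼-cong (∧-cong (∼-cong x≈y) (*-cong x≈y))

  ∇x≈x∨∼x* : ∀ x → ∇ x ≈ x ∨ ∼ (x *)
  ∇x≈x∨∼x* x = trans (∼-∧ (∼ x) (x *)) (∨-congʳ (∼-involutive x))

  x⊑∇x : ∀ x → x ⊑ ∇ x
  x⊑∇x x = ⊑-trans (x≤x∨y x (∼ (x *))) (⊑-reflexive (sym (∇x≈x∨∼x* x)))

  △x⊑x : ∀ x → △ x ⊑ x
  △x⊑x x = ⊑-trans (∼-antitone (x⊑∇x (∼ x))) (⊑-reflexive (∼-involutive x))

  -- Applying `∼` to the modal axiom reverses it and turns both joins into meets.
  ∼x*∧∼x⊑x : ∀ x → ∼ (x *) ∧ ∼ x ⊑ x
  ∼x*∧∼x⊑x x = begin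
    ∼ (x *) ∧ ∼ x    ≈⟨ ∧-comm (∼ (x *)) (∼ x) ⟩
    ∼ x ∧ ∼ (x *)    ≈⟨ ∼-∨ x (x *) ⟨
    ∼ (x ∨ x *)      ≤⟨ ∼-antitone (sym (modal x)) ⟩
    ∼ (x ∨ ∼ x)      ≈⟨ ∼-∨ x (∼ x) ⟩
    ∼ x ∧ ∼ ∼ x      ≤⟨ x∧y≤y (∼ x) (∼ ∼ x) ⟩
    ∼ ∼ x            ≈⟨ ∼-involutive x ⟩
    x                ∎

  -- Since `∇ x` is `x ∨ ∼ (x *)`, the left side splits into a part below `x` and the part bounded
  -- by `∼x*∧∼x⊑x`. Both `∇-complemented` and `determination` rest on this bound.
  ∇x∧∼x⊑x : ∀ x → ∇ x ∧ ∼ x ⊑ x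
  ∇x∧∼x⊑x x = begin
    ∇ x ∧ ∼ x                      ≈⟨ ∧-congʳ (∇x≈x∨∼x* x) ⟩
    (x ∨ ∼ (x *)) ∧ ∼ x            ≈⟨ ∧-distribʳ-∨ (∼ x) x (∼ (x *)) ⟩
    (x ∧ ∼ x) ∨ (∼ (x *) ∧ ∼ x)    ≤⟨ ∨-least (x∧y≤x x (∼ x)) (∼x*∧∼x⊑x x) ⟩
    x                              ∎

  -- Complemented elements.

  Complemented : Carrier → Set ℓ
  Complemented x = x ∧ ∼ x ≈ 0#

  Complemented-resp-≈ : ∀ {x y} → x ≈ y → Complemented x → Complemented y
  Complemented-resp-≈ x≈y = trans (sym (∧-cong x≈y (∼-cong x≈y)))

  ∼-complemented : ∀ {x} → Complemented x → Complemented (∼ x)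
  ∼-complemented {x} x∧∼x≈0 =
    trans (∧-congˡ (∼-involutive x)) (trans (∧-comm (∼ x) x) x∧∼x≈0)

  ∧-complemented : ∀ {x y} → Complemented x → Complemented y → Complemented (x ∧ y)
  ∧-complemented {x} {y} cx cy = antisym xy∧∼xy⊑0 (0⊑x _)
    where
    xy∧∼xy⊑0 : (x ∧ y) ∧ ∼ (x ∧ y) ⊑ 0#
    xy∧∼xy⊑0 = begin
      (x ∧ y) ∧ ∼ (x ∧ y)
        ≈⟨ ∧-congˡ (∼-∧ x y) ⟩
      (x ∧ y) ∧ (∼ x ∨ ∼ y)
        ≈⟨ ∧-distribˡ-∨ (x ∧ y) (∼ x) (∼ y) ⟩
      ((x ∧ y) ∧ ∼ x) ∨ ((x ∧ y) ∧ ∼ y)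
        ≤⟨ ∨-monotonic (∧-monotonic (x∧y≤x x y) ⊑-refl) (∧-monotonic (x∧y≤y x y) ⊑-refl) ⟩
      (x ∧ ∼ x) ∨ (y ∧ ∼ y)
        ≤⟨ ∨-least (⊑-reflexive cx) (⊑-reflexive cy) ⟩
      0#
        ∎

  1-complemented : Complemented 1#
  1-complemented = trans (proj₁ ∧-identity (∼ 1#)) ∼1≈0

  0-complemented : Complemented 0#
  0-complemented = Complemented-resp-≈ ∼1≈0 (∼-complemented 1-complemented)

  -- `∼ ∇ x` equals `∼ x ∧ x *`: meeting `∇ x` with the first factor leaves something below `x`,
  -- which the second factor annihilates.
  ∇-complemented : ∀ x → Complemented (∇ x)
  ∇-complemented x = antisym (begin
    ∇ x ∧ ∼ ∇ x          ≈⟨ ∧-congˡ (∼-involutive (∼ x ∧ x *)) ⟩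
    ∇ x ∧ (∼ x ∧ x *)    ≈⟨ ∧-assoc (∇ x) (∼ x) (x *) ⟨
    (∇ x ∧ ∼ x) ∧ x *    ≤⟨ ∧-monotonic (∇x∧∼x⊑x x) ⊑-refl ⟩
    x ∧ x *              ≈⟨ x∧x*≈0 x ⟩
    0#                   ∎) (0⊑x _)

  △-complemented : ∀ x → Complemented (△ x)
  △-complemented x = ∼-complemented (∇-complemented (∼ x))

  complemented⇒∼x∨x≈1 : ∀ {x} → Complemented x → ∼ x ∨ x ≈ 1#
  complemented⇒∼x∨x≈1 {x} cx = begin-equality
    ∼ x ∨ x        ≈⟨ ∨-congˡ (∼-involutive x) ⟨
    ∼ x ∨ ∼ ∼ x    ≈⟨ ∼-∧ x (∼ x) ⟨
    ∼ (x ∧ ∼ x)    ≈⟨ ∼-cong cx ⟩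
    ∼ 0#           ≈⟨ ∼0≈1 ⟩
    1#             ∎

  complemented⇒x≈∇x : ∀ {x} → Complemented x → x ≈ ∇ x
  complemented⇒x≈∇x {x} cx = begin-equality
    x                  ≈⟨ ∼-involutive x ⟨
    -- `u ⊑ v` unfolds to `u ≈ u ∧ v`, so the bound `∼ x ⊑ x *` is itself the equation required.
    ∼ ∼ x              ≈⟨ ∼-cong (*-greatest (⊑-reflexive cx)) ⟩
    ∼ (∼ x ∧ x *)      ∎

  complemented⇒x≈△x : ∀ {x} → Complemented x → x ≈ △ x
  complemented⇒x≈△x {x} cx =
    trans (sym (∼-involutive x)) (∼-cong (complemented⇒x≈∇x (∼-complemented cx)))

  -- Comparing elements through complemented ones.

  x⊑△x∨∼x : ∀ x → x ⊑ △ x ∨ ∼ x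
  x⊑△x∨∼x x = begin
    x                                  ≤⟨ ∧-greatest (x⊑1 x) ⊑-refl ⟩
    -- `△ x` and `∇ (∼ x)` are complements of each other, so `x` splits along them.
    1# ∧ x                             ≈⟨ ∧-congʳ (complemented⇒∼x∨x≈1 (∇-complemented (∼ x))) ⟨
    (△ x ∨ ∇ (∼ x)) ∧ x                ≈⟨ ∧-distribʳ-∨ x (△ x) (∇ (∼ x)) ⟩
    (△ x ∧ x) ∨ (∇ (∼ x) ∧ x)          ≈⟨ ∨-congˡ (∧-congˡ (∼-involutive x)) ⟨
    (△ x ∧ x) ∨ (∇ (∼ x) ∧ ∼ ∼ x)      ≤⟨ ∨-monotonic (x∧y≤x (△ x) x) (∇x∧∼x⊑x (∼ x)) ⟩
    △ x ∨ ∼ x                          ∎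

  -- Without x ⊑ y this fails: in the four-element algebra with two atoms fixed by ∼,
  -- both atoms are sent to 1 by ∇ and to 0 by △.
  determination : ∀ {x y} → x ⊑ y → ∇ y ⊑ ∇ x → △ y ⊑ △ x → y ⊑ x
  determination {x} {y} x⊑y ∇y⊑∇x △y⊑△x = begin
    -- The bound on `△ y` puts `y` below `x ∨ ∼ x`; the bound on `∇ y` then absorbs the part of `y`
    -- inside `∼ x`.
    y                      ≤⟨ ∧-greatest y⊑x∨∼x ⊑-refl ⟩
    (x ∨ ∼ x) ∧ y          ≈⟨ ∧-distribʳ-∨ y x (∼ x) ⟩
    (x ∧ y) ∨ (∼ x ∧ y)    ≤⟨ ∨-least (x∧y≤x x y) ∼x∧y⊑x ⟩
    x                      ∎
    where
    y⊑x∨∼x : y ⊑ x ∨ ∼ x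
    y⊑x∨∼x = begin
      y            ≤⟨ x⊑△x∨∼x y ⟩
      △ y ∨ ∼ y    ≤⟨ ∨-monotonic (⊑-trans △y⊑△x (△x⊑x x)) (∼-antitone x⊑y) ⟩
      x ∨ ∼ x      ∎

    ∼x∧y⊑x : ∼ x ∧ y ⊑ x
    ∼x∧y⊑x = begin
      ∼ x ∧ y      ≈⟨ ∧-comm (∼ x) y ⟩
      y ∧ ∼ x      ≤⟨ ∧-monotonic (⊑-trans (x⊑∇x y) ∇y⊑∇x) ⊑-refl ⟩
      ∇ x ∧ ∼ x    ≤⟨ ∇x∧∼x⊑x x ⟩
      x            ∎

  -- For complemented `x`, `∼ x ∨ y` acts as the Boolean implication from `x` to `y`. This turns an
  -- equation with `1#` into an inequality.
  ∼x∨y≈1⇒x⊑y : ∀ {x y} → Complemented x → ∼ x ∨ y ≈ 1# → x ⊑ y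
  ∼x∨y≈1⇒x⊑y {x} {y} cx ∼x∨y≈1 = begin
    x                      ≤⟨ ∧-greatest ⊑-refl (x⊑1 x) ⟩
    x ∧ 1#                 ≈⟨ ∧-congˡ ∼x∨y≈1 ⟨
    x ∧ (∼ x ∨ y)          ≈⟨ ∧-distribˡ-∨ x (∼ x) y ⟩
    (x ∧ ∼ x) ∨ (x ∧ y)    ≤⟨ ∨-least (⊑-trans (⊑-reflexive cx) (0⊑x y)) (x∧y≤y x y) ⟩
    y                      ∎

  -- This and the next two lemmas show that an operation, cut down to the interval below `x`,
  -- depends only on the arguments cut down to `x`. They make `a ∧ x ≈ b ∧ x` a congruence.
  ∼-∧-relative : ∀ {x} a → Complemented x → ∼ a ∧ x ≈ ∼ (a ∧ x) ∧ x
  ∼-∧-relative {x} a cx = begin-equality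
    ∼ a ∧ x                ≈⟨ proj₂ ∨-identity (∼ a ∧ x) ⟨
    (∼ a ∧ x) ∨ 0#         ≈⟨ ∨-congˡ (trans (∧-comm (∼ x) x) cx) ⟨
    (∼ a ∧ x) ∨ (∼ x ∧ x)  ≈⟨ ∧-distribʳ-∨ x (∼ a) (∼ x) ⟨
    (∼ a ∨ ∼ x) ∧ x        ≈⟨ ∧-congʳ (∼-∧ a x) ⟨
    ∼ (a ∧ x) ∧ x          ∎

  *-∧-relative : ∀ a x → a * ∧ x ≈ (a ∧ x) * ∧ x
  *-∧-relative a x = antisym
    (∧-monotonic (*-antitone (x∧y≤x a x)) ⊑-refl)
    (∧-greatest (*-greatest a∧[ax]*x⊑0) (x∧y≤y ((a ∧ x) *) x))
    where
    a∧[ax]*x⊑0 : a ∧ ((a ∧ x) * ∧ x) ⊑ 0#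
    a∧[ax]*x⊑0 = begin
      a ∧ ((a ∧ x) * ∧ x)    ≈⟨ ∧-congˡ (∧-comm ((a ∧ x) *) x) ⟩
      a ∧ (x ∧ (a ∧ x) *)    ≈⟨ ∧-assoc a x ((a ∧ x) *) ⟨
      (a ∧ x) ∧ (a ∧ x) *    ≈⟨ x∧x*≈0 (a ∧ x) ⟩
      0#                     ∎

  ∧-∧-relative : ∀ a b x → (a ∧ b) ∧ x ≈ (a ∧ x) ∧ (b ∧ x)
  ∧-∧-relative a b x = antisym
    (∧-greatest (∧-monotonic (x∧y≤x a b) ⊑-refl) (∧-monotonic (x∧y≤y a b) ⊑-refl))
    (∧-greatest (∧-monotonic (x∧y≤x a x) (x∧y≤x b x)) (⊑-trans (x∧y≤x _ _) (x∧y≤y a x)))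

module CAlgebraProperties {c ℓ k} (A : CAlgebra k c ℓ) where
  open CAlgebra A hiding (_≤_)
  open MpMAlgebraProperties mpMAlgebra public
  open IsMpMAutomorphism isMpMAutomorphism using (∧-homo; ∼-homo; 0#-homo; 1#-homo)
    renaming (⟦⟧-cong to t-cong)
  open PartialOrderReasoning poset

  -- The automorphism, `K` and finite meets.

  t-complemented : ∀ {x} → Complemented x → Complemented (t x)
  t-complemented {x} cx = begin-equality
    t x ∧ ∼ t x      ≈⟨ ∧-congˡ (∼-homo x) ⟨
    t x ∧ t (∼ x)    ≈⟨ ∧-homo x (∼ x) ⟨
    t (x ∧ ∼ x)      ≈⟨ t-cong cx ⟩
    t 0#             ≈⟨ 0#-homo ⟩
    0#               ∎

  t^-complemented : ∀ {x} j → Complemented x → Complemented ((t^ j) x)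
  t^-complemented zero    cx = cx
  t^-complemented (suc j) cx = t-complemented (t^-complemented j cx)

  t^-fixed : ∀ {x} j → t x ≈ x → (t^ j) x ≈ x
  t^-fixed zero    tx≈x = refl
  t^-fixed (suc j) tx≈x = trans (t-cong (t^-fixed j tx≈x)) tx≈x

  K⇒complemented : ∀ {x} → K x → Complemented x
  K⇒complemented {x} (_ , x≈∇x) = Complemented-resp-≈ (sym x≈∇x) (∇-complemented x)

  K-resp-≈ : ∀ {x y} → x ≈ y → K x → K y
  K-resp-≈ x≈y (tx≈x , x≈∇x) =
    trans (t-cong (sym x≈y)) (trans tx≈x x≈y) , trans (sym x≈y) (trans x≈∇x (∇-cong x≈y))

  ｛0,1｝⊆K : ∀ {x} → ｛0,1｝ x → K x
  ｛0,1｝⊆K (inj₁ x≈0) = K-resp-≈ (sym x≈0) (0#-homo , complemented⇒x≈∇x 0-complemented)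
  ｛0,1｝⊆K (inj₂ x≈1) = K-resp-≈ (sym x≈1) (1#-homo , complemented⇒x≈∇x 1-complemented)

  ⋀-complemented : ∀ n {f} → (∀ j → Complemented (f j)) → Complemented (⋀[1⋯ n ] f)
  ⋀-complemented zero    cf = 1-complemented
  ⋀-complemented (suc n) cf = ∧-complemented (⋀-complemented n cf) (cf (suc n))

  t-⋀ : ∀ n f → t (⋀[1⋯ n ] f) ≈ ⋀[1⋯ n ] (t ∘ f)
  t-⋀ zero    f = 1#-homo
  t-⋀ (suc n) f = trans (∧-homo (⋀[1⋯ n ] f) (f (suc n))) (∧-congʳ (t-⋀ n f))

  ⋀-unfoldˡ : ∀ n f → ⋀[1⋯ suc n ] f ≈ f 1 ∧ ⋀[1⋯ n ] (f ∘ suc)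
  ⋀-unfoldˡ zero    f = ∧-comm 1# (f 1)
  ⋀-unfoldˡ (suc n) f = trans (∧-congʳ (⋀-unfoldˡ n f)) (∧-assoc _ _ _)

  -- The length is `suc n` because the empty meet is `1#`, whatever `x` is.
  ⋀-constant : ∀ n {f x} → (∀ j → f j ≈ x) → ⋀[1⋯ suc n ] f ≈ x
  ⋀-constant zero        fj≈x = trans (proj₁ ∧-identity _) (fj≈x 1)
  ⋀-constant (suc n) {x = x} fj≈x =
    trans (∧-cong (⋀-constant n fj≈x) (fj≈x (suc (suc n)))) (∧-idem x)

  -- The congruence induced by an element of `K`.

  simple⇒K⊆｛0,1｝ : Simple → ∀ {x} → K x → ｛0,1｝ x
  simple⇒K⊆｛0,1｝ simple {x} x∈K@(tx≈x , _) = conclude (simple θ θ-isCongruence)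
    where
    cx : Complemented x
    cx = K⇒complemented x∈K

    θ : Rel Carrier (c ⊔ ℓ)
    -- The lift raises the relation to the level over which `Simple` quantifies.
    θ a b = Lift c (a ∧ x ≈ b ∧ x)

    t-relative : ∀ a → t a ∧ x ≈ t (a ∧ x)
    t-relative a = trans (∧-congˡ (sym tx≈x)) (sym (∧-homo a x))

    θ-isCongruence : IsCongruence θ
    θ-isCongruence = record
      { isEquivalence = record
        { refl  = lift refl
        ; sym   = λ (lift p) → lift (sym p)
        ; trans = λ (lift p) (lift q) → lift (trans p q)
        }
      ; ≈⇒θ          = λ a≈b → lift (∧-congʳ a≈b)
      ; ∧-compatible = λ {a} {a′} {b} {b′} (lift p) (lift q) → lift
          (trans (∧-∧-relative a b x) (trans (∧-cong p q) (sym (∧-∧-relative a′ b′ x))))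
      ; ∨-compatible = λ {a} {a′} {b} {b′} (lift p) (lift q) → lift
          (trans (∧-distribʳ-∨ x a b) (trans (∨-cong p q) (sym (∧-distribʳ-∨ x a′ b′))))
      ; ∼-compatible = λ {a} {b} (lift p) → lift
          (trans (∼-∧-relative a cx) (trans (∧-congʳ (∼-cong p)) (sym (∼-∧-relative b cx))))
      ; *-compatible = λ {a} {b} (lift p) → lift
          (trans (*-∧-relative a x) (trans (∧-congʳ (*-cong p)) (sym (*-∧-relative b x))))
      ; t-compatible = λ {a} {b} (lift p) → lift
          (trans (t-relative a) (trans (t-cong p) (sym (t-relative b))))
      }

    xθ1 : θ x 1#
    xθ1 = lift (trans (∧-idem x) (sym (proj₁ ∧-identity x)))

    conclude : (θ ⇒ _≈_) ⊎ Universal θ → ｛0,1｝ x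
    conclude (inj₁ θ⇒≈) = inj₂ (θ⇒≈ xθ1)
    conclude (inj₂ θ-universal) = inj₁ (begin-equality
      x         ≈⟨ proj₁ ∧-identity x ⟨
      1# ∧ x    ≈⟨ lower (θ-universal 1# 0#) ⟩
      0# ∧ x    ≈⟨ 0⊑x x ⟨
      0#        ∎)

  -- Arbitrary congruences and their class of `1#`.

  module Congruence {p} {θ : Rel Carrier p} (θ-isCongruence : IsCongruence θ) where
    open IsCongruence θ-isCongruence
    private module θ = IsEquivalence (IsCongruence.isEquivalence θ-isCongruence)

    ∇-compatible : ∀ {a b} → θ a b → θ (∇ a) (∇ b)
    ∇-compatible aθb = ∼-compatible (∧-compatible (∼-compatible aθb) (*-compatible aθb))

    △-compatible : ∀ {a b} → θ a b → θ (△ a) (△ b)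
    △-compatible aθb = ∼-compatible (∇-compatible (∼-compatible aθb))

    t^-compatible : ∀ {a b} j → θ a b → θ ((t^ j) a) ((t^ j) b)
    t^-compatible zero    aθb = aθb
    t^-compatible (suc j) aθb = t-compatible (t^-compatible j aθb)

    ⋀-compatible : ∀ {f g} n → (∀ j → θ (f j) (g j)) → θ (⋀[1⋯ n ] f) (⋀[1⋯ n ] g)
    ⋀-compatible zero    fθg = θ.refl
    ⋀-compatible (suc n) fθg = ∧-compatible (⋀-compatible n fθg) (fθg (suc n))

    0θ1⇒universal : θ 0# 1# → Universal θ
    0θ1⇒universal 0θ1 a b = θ.trans (θ.sym (0θ a)) (0θ b)
      where
      0θ : ∀ a → θ 0# a
      0θ a = θ.trans (≈⇒θ (0⊑x a))
        (θ.trans (∧-compatible 0θ1 θ.refl) (≈⇒θ (proj₁ ∧-identity a)))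

    module _ (θ1⇒≈1 : ∀ {e} → θ e 1# → e ≈ 1#) where

      -- The implication `∼ a ∨ b` is congruent to `∼ a ∨ a`, which is `1#`; hence it equals `1#`.
      complemented-⊑ : ∀ {a b} → Complemented a → θ a b → a ⊑ b
      complemented-⊑ ca aθb = ∼x∨y≈1⇒x⊑y ca (θ1⇒≈1
        (θ.trans (∨-compatible θ.refl (θ.sym aθb)) (≈⇒θ (complemented⇒∼x∨x≈1 ca))))

      -- `determination` needs comparable elements, so `b` is replaced by `a ∧ b`, which is still
      -- congruent to `a`.
      θ⇒⊑ : ∀ {a b} → θ a b → a ⊑ b
      θ⇒⊑ {a} {b} aθb = ⊑-trans
        (determination (x∧y≤x a b)
          (complemented-⊑ (∇-complemented a) (∇-compatible aθa∧b))
          (complemented-⊑ (△-complemented a) (△-compatible aθa∧b)))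
        (x∧y≤y a b)
        where
        aθa∧b : θ a (a ∧ b)
        aθa∧b = θ.trans (≈⇒θ (sym (∧-idem a))) (∧-compatible θ.refl aθb)

      θ⇒≈ : θ ⇒ _≈_
      θ⇒≈ aθb = antisym (θ⇒⊑ aθb) (θ⇒⊑ (θ.sym aθb))

-- Orbit meets and the remaining implications.

module _ {c ℓ n} (A : CAlgebra (suc n) c ℓ) where
  open CAlgebra A hiding (_≤_)
  open CAlgebraProperties A
  open IsMpMAutomorphism isMpMAutomorphism using () renaming (⟦⟧-cong to t-cong)
  open PartialOrderReasoning poset

  private
    orbitMeet : Carrier → Carrier
    orbitMeet x = ⋀[1⋯ suc n ] (λ j → (t^ j) x)

  -- `t` rotates the factors: the last one, `x` itself up to `≈`, becomes `t x`, the first one of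
  -- the original meet.
  t-orbitMeet : ∀ x → t (orbitMeet x) ≈ orbitMeet x
  t-orbitMeet x = begin-equality
    t (orbitMeet x)
      ≈⟨ t-⋀ (suc n) f ⟩
    ⋀[1⋯ n ] (f ∘ suc) ∧ t ((t^ suc n) x)
      ≈⟨ ∧-congˡ (t-cong (t^k≈id x)) ⟩
    ⋀[1⋯ n ] (f ∘ suc) ∧ f 1
      ≈⟨ ∧-comm _ (f 1) ⟩
    f 1 ∧ ⋀[1⋯ n ] (f ∘ suc)
      ≈⟨ ⋀-unfoldˡ n f ⟨
    orbitMeet x
      ∎
    where
    f : ℕ → Carrier
    f j = (t^ j) x

  -- The last factor is the full power of `t`, which is the identity.
  orbitMeet⊑x : ∀ x → orbitMeet x ⊑ x
  orbitMeet⊑x x = ⊑-trans (x∧y≤y _ _) (⊑-reflexive (t^k≈id x))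

  orbitMeet∈K : ∀ {x} → Complemented x → K (orbitMeet x)
  orbitMeet∈K {x} cx =
    t-orbitMeet x ,
    complemented⇒x≈∇x (⋀-complemented (suc n) (λ j → t^-complemented j cx))

  orbitMeet-△-K : ∀ {x} → K x → orbitMeet (△ x) ≈ x
  orbitMeet-△-K {x} x∈K@(tx≈x , _) =
    ⋀-constant n (λ j → trans (t^-fixed j t△x≈△x) (sym x≈△x))
    where
    x≈△x : x ≈ △ x
    x≈△x = complemented⇒x≈△x (K⇒complemented x∈K)

    t△x≈△x : t (△ x) ≈ △ x
    t△x≈△x = trans (t-cong (sym x≈△x)) (trans tx≈x x≈△x)

  KTrivial⇒OrbitMeetsVanish : KTrivial → OrbitMeetsVanish
  KTrivial⇒OrbitMeetsVanish (K⊆｛0,1｝ , _) a a≉1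
    with K⊆｛0,1｝ (orbitMeet∈K (△-complemented a))
  ... | inj₁ m≈0 = m≈0
  ... | inj₂ m≈1 = contradiction (antisym (x⊑1 a) 1⊑a) a≉1
    where
    1⊑a : 1# ⊑ a
    1⊑a = begin
      1#                 ≈⟨ m≈1 ⟨
      orbitMeet (△ a)    ≤⟨ orbitMeet⊑x (△ a) ⟩
      △ a                ≤⟨ △x⊑x a ⟩
      a                  ∎

  ≈-dec : ExcludedMiddle (c ⊔ ℓ) → ∀ x y → Dec (x ≈ y)
  ≈-dec em x y = map′ lower lift (em {Lift c (x ≈ y)})

  OrbitMeetsVanish⇒KTrivial : ExcludedMiddle (c ⊔ ℓ) → OrbitMeetsVanish → KTrivial
  OrbitMeetsVanish⇒KTrivial em vanish = K⊆｛0,1｝ , ｛0,1｝⊆K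
    where
    K⊆｛0,1｝ : ∀ {x} → K x → ｛0,1｝ x
    K⊆｛0,1｝ {x} x∈K with ≈-dec em x 1#
    ... | yes x≈1 = inj₂ x≈1
    ... | no  x≉1 = inj₁ (trans (sym (orbitMeet-△-K x∈K)) (vanish x x≉1))

  OrbitMeetsVanish⇒Simple : ExcludedMiddle (c ⊔ ℓ) → OrbitMeetsVanish → Simple
  OrbitMeetsVanish⇒Simple em vanish θ θ-isCongruence
    -- The cases are whether or not the class of `1#` contains a further element.
    with em {∃ λ e → θ e 1# × ¬ (e ≈ 1#)}
  ... | yes (e , eθ1 , e≉1) = inj₂ (0θ1⇒universal 0θ1)
    where
    open Congruence θ-isCongruence
    open IsCongruence θ-isCongruence
    module θ = IsEquivalence (IsCongruence.isEquivalence θ-isCongruence)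

    0θ1 : θ 0# 1#
    -- The orbit meet of `△ e` is `0#`; it is congruent to that of `△ 1#`, which is `1#` because
    -- `1#` lies in `K`.
    0θ1 = θ.trans (≈⇒θ (sym (vanish e e≉1)))
      (θ.trans (⋀-compatible (suc n) (λ j → t^-compatible j (△-compatible eθ1)))
        (≈⇒θ (orbitMeet-△-K (｛0,1｝⊆K (inj₂ refl)))))
  ... | no ∄e = inj₁ (θ⇒≈ λ {e} eθ1 →
    decidable-stable (≈-dec em e 1#) (λ e≉1 → ∄e (e , eθ1 , e≉1)))
    where open Congruence θ-isCongruence

theorem4p5 : ∀ {c ℓ : Level} → ExcludedMiddle (c ⊔ ℓ) →
    ∀ (k : ℕ) → 1 ≤ k → (A : CAlgebra k c ℓ) →
    let module A = CAlgebra A in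
    A.Nontrivial → (A.Simple ⇔ A.OrbitMeetsVanish) × (A.OrbitMeetsVanish ⇔ A.KTrivial)
theorem4p5 em (suc n) (s≤s _) A _ =
  -- The passage from (i) to (ii) goes through (iii).
  mk⇔ (λ simple → KTrivial⇒OrbitMeetsVanish A (simple⇒K⊆｛0,1｝ simple , ｛0,1｝⊆K))
      (OrbitMeetsVanish⇒Simple A em) ,
  mk⇔ (OrbitMeetsVanish⇒KTrivial A em) (KTrivial⇒OrbitMeetsVanish A)
  where open CAlgebraProperties A
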